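{- Let $q\ge3$ be an integer, let $n$ be an integer with $3\nmid n$, and suppose $n\ge45q-60$. If $G$ is an oriented graph on $n$ vertices with $\delta^0(G)\ge\lceil n/3\rceil$, then every vertex of $G$ lies on a copy of $C_{3q}$ in $G$.
   Context: An oriented graph is an orientation of a (finite) simple graph: no loops, and at most one arc on each unordered pair of vertices. $\delta^0(G)=\min_{v}\min\{d^+(v),d^-(v)\}$ is the minimum semidegree. $C_\ell$ denotes the consistently oriented (directed) cycle of length $\ell$ (with $\ell$ distinct vertices). -}

module Defs where

open import Data.Fin.Base using (Fin; toℕ)
open import Data.List.Base using (length; filter; map; allFin)
open import Data.List.Extrema.Nat using (min)
open import Data.Nat.Base using (ℕ; suc; pred; _+_; _⊓_; _/_; NonZero)
open import Data.Nat.DivMod using (_mod_)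
open import Data.Product.Base using (∃-syntax)
open import Function.Definitions using (Injective)
open import Level using (0ℓ)
open import Relation.Binary.Core using (Rel)
open import Relation.Binary.Definitions using (Asymmetric; Decidable)
open import Relation.Binary.PropositionalEquality using (_≡_)

⌈_/_⌉ : (m d : ℕ) .{{_ : NonZero d}} → ℕ
⌈ m / d ⌉ = (m + pred d) / d

-- Asymmetry on distinct vertices says that each unordered pair carries at
-- most one arc; asymmetry at u = v rules out loops.
record OrientedGraph (n : ℕ) : Set₁ where
  infix 4 _⟶_ _⟶?_
  field
    _⟶_  : Rel (Fin n) 0ℓ
    _⟶?_ : Decidable _⟶_
    asym : Asymmetric _⟶_

  d⁺ : Fin n → ℕ
  d⁺ v = length (filter (λ w → v ⟶? w) (allFin n))

  d⁻ : Fin n → ℕ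
  d⁻ v = length (filter (λ u → u ⟶? v) (allFin n))

  -- The first argument of min is an extra candidate value.  Since no degree
  -- exceeds n, it does not affect the minimum when there is a vertex.
  δ⁰ : ℕ
  δ⁰ = min n (map (λ v → d⁺ v ⊓ d⁻ v) (allFin n))

next : ∀ {ℓ} → Fin ℓ → Fin ℓ
next {suc k} i = suc (toℕ i) mod suc k

-- A copy of the directed cycle 0 ⟶ 1 ⟶ … ⟶ ℓ-1 ⟶ 0 in G; not necessarily
-- induced.
record DirectedCycle {n : ℕ} (G : OrientedGraph n) (ℓ : ℕ) : Set where
  open OrientedGraph G
  field
    vertex    : Fin ℓ → Fin n
    injective : Injective _≡_ _≡_ vertex
    arc       : ∀ i → vertex i ⟶ vertex (next i)

LiesOn : ∀ {n ℓ} {G : OrientedGraph n} → Fin n → DirectedCycle G ℓ → Set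
LiesOn v C = ∃[ i ] DirectedCycle.vertex C i ≡ v

{-# OPTIONS --safe #-}

-- Let δ = δ⁰(G), so that n < 3δ.  An independent in-neighbourhood N⁻(x) would
-- force n ≥ 3δ, since it is disjoint from both neighbourhoods of any member;
-- hence every N⁻(x) contains an arc.  Two such arcs, in N⁻(v) and then in
-- N⁻(z) for the tail z of the first, give a vertex y joined to v by paths of
-- lengths 2, 3 and 4 on the same five vertices.  Extend greedily backwards from
-- y by 3q − 7 steps to a vertex w.  Let W be the set of unused vertices.  It
-- remains to return from v to w inside W by a path of length 3, 4 or 5, whichever
-- it is: the total can be adjusted to 3q on the way from y to v.
--
-- Write A = N⁺(v) ∩ W, B = N⁻(w) ∩ W, and suppose that there is no such path.  Let
-- S be the union of A ∖ B and its out-neighbours in W, and T the union of B ∖ A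
-- and its in-neighbours in W.  Then S, T and A ∩ B are disjoint, the arcs leaving
-- A ∖ B stay in S, and those leaving S miss T and A ∩ B.  When |S| ≤ |T|, counting
-- the arcs that leave S, of which at most half of |S|² stay inside, contradicts
-- 2|W| + 7 ≤ 7d, where d bounds all semidegrees into W ∪ {v, w} from below.  The
-- case |T| ≤ |S| is symmetric.  If A ⊆ B, then S is empty, and that case is treated
-- with S = N⁺(a) and T = N⁻(b) for distinct a, b ∈ A.
module Submission where

open import Defs
open import Data.Empty using (⊥)
open import Data.Fin.Base using (Fin; zero; suc; toℕ)
open import Data.Fin.Properties using (_≟_; any?; suc-injective; toℕ-injective; toℕ-fromℕ<; toℕ<n)
open import Data.List.Base 
  using (List; []; _∷_; _++_; length; filter; tabulate; map; lookup; allFin)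
open import Data.List.Extrema.Nat using (min≤xs)
import Data.List.Membership.DecPropositional as DecMembership
open import Data.List.Membership.Propositional using (_∈_; _∉_)
open import Data.List.Membership.Propositional.Properties using (∈-lookup; ∈-allFin; ∈-map⁺; ∈-++⁻)
open import Data.List.Properties using (length-++)
open import Data.Nat.Base
  using (ℕ; zero; suc; _+_; _*_; _∸_; _⊓_; _≤_; _<_; _≥_; z≤n; s≤s; _%_)
open import Data.Nat.Divisibility using (_∤_; divides)
open import Data.Nat.DivMod using (m≡m%n+[m/n]*n; m%n<n; n%n≡0; m<n⇒m%n≡m)
open import Data.Nat.ListAction using (sum)
open import Data.Nat.Properties hiding (_≟_; suc-injective)
open import Data.Nat.Tactic.RingSolver using (solve; solve-∀)
open import Data.Product.Base using (∃; ∃-syntax; Σ-syntax; _×_; _,_; proj₁; proj₂)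
open import Data.Sum.Base using (_⊎_; inj₁; inj₂; [_,_]′)
open import Function.Base using (_∘_; id)
open import Level using (0ℓ)
open import Relation.Binary.PropositionalEquality
open import Relation.Nullary using (Dec; yes; no; ¬_; contradiction)
open import Relation.Nullary.Decidable using (_×-dec_; _⊎-dec_; ¬?; decidable-stable)
open import Relation.Unary using (Pred; Decidable; _∩_; _∪_; ∁; _⊆_; U)
open import Relation.Unary.Properties using (_∩?_; ∁?; U?)
open import Algebra.Properties.Semiring.Sum +-*-semiring
  using (∑-distrib-+; ∑-comm; *-distribˡ-sum; *-distribʳ-sum; sum-cong-≋)
  renaming (sum to ∑)

-- Inequalities

≤⇒∃+ : ∀ {m n} → m ≤ n → ∃[ o ] n ≡ m + o
≤⇒∃+ m≤n = _ , sym (m+[n∸m]≡n m≤n)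

-- The types of +-mono-≤ and *-monoʳ-≤ hide the sums and products from the
-- reflection of the ring solver.
infixl 6 _⊞_
infixl 7 _⊠_

_⊞_ : ∀ {a b c d} → a ≤ b → c ≤ d → a + c ≤ b + d
_⊞_ = +-mono-≤

_⊠_ : ∀ k {a b} → a ≤ b → k * a ≤ k * b
k ⊠ a≤b = *-monoʳ-≤ k a≤b

-- A linear consequence x ≤ y of a combination l ≤ r of known inequalities,
-- checked by a semiring identity with slack c.
linear : ∀ {x y l r} c → l ≤ r → x + r + c ≡ y + l → x ≤ y
linear {x} {y} {l} {r} c l≤r eq = +-cancelʳ-≤ r x y (begin
  x + r       ≤⟨ m≤m+n (x + r) c ⟩
  x + r + c   ≡⟨ eq ⟩
  y + l       ≤⟨ +-monoʳ-≤ y l≤r ⟩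
  y + r       ∎)
  where open ≤-Reasoning

-- Multiplied by `k`, the last bound eliminates `r` from the quadratic one and leaves (d - k)(d -
-- 2k) + 2hk ≤ h². This fails because 0 < h ≤ k and d - k ≤ h.
quadratic-gap : ∀ {h k r d} → 1 ≤ h → h ≤ k → d ≤ h + k →
                d * d ≤ h * h + 2 * (k * r) → 2 * (h + k + r) ≤ 3 * d → ⊥
quadratic-gap {h} {k} {r} {d} 1≤h h≤k d≤h+k d²≤ sum≤ =
  [ below 1≤h h≤k d≤h+k combined , above 1≤h h≤k combined ]′ (≤-total k d)
  where
  combined : d * d + 2 * (h * k) + 2 * (k * k) ≤ h * h + 3 * (d * k)
  combined = linear 0 (d²≤ ⊞ k ⊠ sum≤) (solve (h ∷ k ∷ r ∷ d ∷ []))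

  above : ∀ {h k d} → 1 ≤ h → h ≤ k →
          d * d + 2 * (h * k) + 2 * (k * k) ≤ h * h + 3 * (d * k) → d ≤ k → ⊥
  above {h} {_} {d} 1≤h h≤k combined d≤k with t , refl ← ≤⇒∃+ d≤k =
    contradiction (≤-trans (*-mono-≤ 1≤h (≤-trans 1≤h h≤k)) hk≤0) λ ()
    where
    hk≤0 : h * (d + t) ≤ 0
    hk≤0 = linear (d * t + 2 * (t * t)) (combined ⊞ h ⊠ h≤k) (solve (h ∷ d ∷ t ∷ []))

  below : ∀ {h k d} → 1 ≤ h → h ≤ k → d ≤ h + k →
          d * d + 2 * (h * k) + 2 * (k * k) ≤ h * h + 3 * (d * k) → k ≤ d → ⊥
  below {h} {k} {d} 1≤h h≤k d≤h+k combined k≤d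
    with g , refl ← ≤⇒∃+ k≤d
    with u , refl ← ≤⇒∃+ (+-cancelˡ-≤ k g h (≤-trans d≤h+k (≤-reflexive (+-comm h k))))
    with w , refl ← ≤⇒∃+ h≤k =
    contradiction (≤-trans (*-mono-≤ 1≤h 1≤h) h²≤0) λ ()
    where
    h²≤0 : (g + u) * (g + u) ≤ 0
    -- Here d = k + g, h = g + u and k = h + w. Doubling turns g² + gu + u² into (g + u)² + g² + u².
    h²≤0 = linear (g * g + 2 * (g * w) + u * u + 4 * (u * w)) (2 ⊠ combined)
             (solve (g ∷ u ∷ w ∷ []))

cancel-count : ∀ {m d e} → 1 ≤ m → 2 * (m * d) + m ≤ m * m + 2 * (m * e) → 2 * d + 1 ≤ m + 2 * e
cancel-count {suc m} {d} {e} _ count =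
  *-cancelˡ-≤ (suc m) (linear 0 count (solve (m ∷ d ∷ e ∷ [])))

-- In the next two lemmas r is the number of vertices of W outside the named sets,
-- and r + 1 counts the start of the path as well, which W excludes.
one-sided-gap : ∀ {d s b a r w} → d ≤ s + 1 → d ≤ b + 1 → d ≤ a + 1 →
  1 ≤ s → 2 * (s * d) + s ≤ s * s + 2 * (s * (r + 1)) →
  s + (b + (a + r)) ≤ w → 2 * w + 7 ≤ 7 * d → ⊥
one-sided-gap {d} {s} {b} {a} {r} {w} d≤s d≤b d≤a 1≤s count w≥ w≤ =
  contradiction 1≤0 λ ()
  where
  1≤0 : 1 ≤ 0
  1≤0 = linear 0 (w≤ ⊞ cancel-count {s} {d} {r + 1} 1≤s count ⊞ d≤s ⊞ 2 ⊠ (d≤b ⊞ d≤a) ⊞ 2 ⊠ w≥)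
    (solve (d ∷ s ∷ b ∷ a ∷ r ∷ w ∷ []))

-- With the sets of the introduction, s = |S|, t = |T|, m = |A ∖ B|, k = s − m and
-- i = |A ∩ B|.  The first two bounds count the arcs leaving A ∖ B and S.
-- quadratic-gap applies with h = s − d, and with k when m ≤ d, h when d ≤ m.
two-sided-gap : ∀ {d s t m k i r w} → 1 ≤ m →
  2 * (m * d) + m ≤ m * m + 2 * (m * k) →
  2 * (s * d) + s ≤ s * s + 2 * (k * (r + 1)) →
  s ≤ m + k → m + k ≤ s → s ≤ t → d ≤ m + i + 1 →
  s + (t + (i + r)) ≤ w → 2 * w + 7 ≤ 7 * d → ⊥
two-sided-gap {d} {_} {t} {m} {k} {i} {r} {w} 1≤m inner outer s≤ s≥ s≤t d≤ w≥ w≤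
  with refl ← ≤-antisym s≤ s≥ = result (≤⇒∃+ d<s) (≤-total m d)
  where
  inner′ : 2 * d + 1 ≤ m + 2 * k
  inner′ = cancel-count 1≤m inner

  d<s : suc d ≤ m + k
  d<s = *-cancelˡ-≤ 2 (linear 0 (inner′ ⊞ 1≤m) (solve (d ∷ m ∷ k ∷ [])))

  -- For s = m + k = d + h, the difference s² - 2sd equals h² - d²; the summand s is left as slack.
  outer′ : ∀ {h} → m + k ≡ d + h → d * d ≤ h * h + 2 * (k * (r + 1))
  outer′ {h} s≡ = linear (d + h)
    (subst (λ s → 2 * (s * d) + s ≤ s * s + 2 * (k * (r + 1))) s≡ outer)
    (solve (d ∷ h ∷ k ∷ r ∷ []))

  total : 2 * (m + k + (m + k + (i + r))) + 7 ≤ 7 * d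
  total = linear 0 (w≤ ⊞ 2 ⊠ (w≥ ⊞ s≤t))
            (solve (d ∷ t ∷ m ∷ k ∷ i ∷ r ∷ w ∷ []))

  result : ∃[ o ] m + k ≡ suc d + o → m ≤ d ⊎ d ≤ m → ⊥
  result (o , s≡) = large (suc o) (s≤s z≤n) (trans s≡ (sym (+-suc d o)))
    where
    large : ∀ h → 1 ≤ h → m + k ≡ d + h → m ≤ d ⊎ d ≤ m → ⊥
    large h 1≤h s≡ = [ few , many ]′
      where
      s≥′ : d + h ≤ m + k
      s≥′ = ≤-reflexive (sym s≡)

      few : m ≤ d → ⊥
      few m≤d = quadratic-gap {r = r + 1} {d} 1≤h h≤k d≤h+k (outer′ s≡) sum≤
        where
        h≤k : h ≤ k
        h≤k = linear 0 (s≥′ ⊞ m≤d) (solve (d ∷ h ∷ m ∷ k ∷ []))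
        d≤h+k : d ≤ h + k
        d≤h+k = linear 1 (inner′ ⊞ ≤-reflexive s≡) (solve (d ∷ h ∷ m ∷ k ∷ []))
        sum≤ : 2 * (h + k + (r + 1)) ≤ 3 * d
        sum≤ = linear 3 (total ⊞ 2 ⊠ (d≤ ⊞ s≥′))
                 (solve (d ∷ h ∷ m ∷ k ∷ i ∷ r ∷ []))

      many : d ≤ m → ⊥
      many d≤m = quadratic-gap {h} {h} {r + 1} {d} 1≤h ≤-refl d≤2h
                   (≤-trans (outer′ s≡) (+-monoʳ-≤ (h * h) (*-monoʳ-≤ 2 (*-monoˡ-≤ (r + 1) k≤h))))
                   sum≤
        where
        k≤h : k ≤ h
        k≤h = linear 0 (≤-reflexive s≡ ⊞ d≤m) (solve (d ∷ h ∷ m ∷ k ∷ []))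
        d≤2h : d ≤ h + h
        d≤2h = linear 1 (inner′ ⊞ d≤m ⊞ 2 ⊠ ≤-reflexive s≡)
                 (solve (d ∷ h ∷ m ∷ k ∷ []))
        sum≤ : 2 * (h + h + (r + 1)) ≤ 3 * d
        sum≤ = linear (2 * i + 5) (total ⊞ 4 ⊠ s≥′)
                 (solve (d ∷ h ∷ m ∷ k ∷ i ∷ r ∷ []))

-- f = 3q − 4 will be the number of used vertices other than the ends v and w.
module Bounds {n f δ : ℕ} (1≤f : 1 ≤ f) (15f≤n : 15 * f ≤ n) (n<3δ : n < δ * 3) where

  2+f≤δ : 2 + f ≤ δ
  2+f≤δ = *-cancelˡ-≤ 3 (linear 7 (n<3δ ⊞ 15f≤n ⊞ 12 ⊠ 1≤f) (solve (n ∷ f ∷ δ ∷ [])))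

  -- Writing δ as f + d keeps truncated subtraction out of the ring solver.
  n<3δ′ : n < (f + (δ ∸ f)) * 3
  n<3δ′ = subst (λ δ → n < δ * 3) (sym (m+[n∸m]≡n (≤-trans (m≤n+m f 2) 2+f≤δ))) n<3δ

  3≤δ∸f : 3 ≤ δ ∸ f
  3≤δ∸f = large _ n<3δ′
    where
    large : ∀ d → n < (f + d) * 3 → 3 ≤ d
    large d n<3δ = *-cancelˡ-≤ 3 (linear 4 (n<3δ ⊞ 15f≤n ⊞ 12 ⊠ 1≤f) (solve (n ∷ f ∷ d ∷ [])))

  tight : ∀ {w} → w + (2 + f) ≤ n → 2 * w + 7 ≤ 7 * (δ ∸ f)
  tight {w} w≤ = small _ n<3δ′
    where
    small : ∀ d → n < (f + d) * 3 → 2 * w + 7 ≤ 7 * d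
    -- The combination amounts to 6w + 19 ≤ 21d; cancelling 3 in a strict inequality rounds 19/3 up
    -- to 7.
    small d n<3δ = ≤-pred (*-cancelˡ-< 3 (2 * w + 7) (suc (7 * d))
      (linear 0 (6 ⊠ w≤ ⊞ 7 ⊠ n<3δ ⊞ 15f≤n) (solve (n ∷ w ∷ f ∷ d ∷ []))))

-- The summands count `v`, the interior of the return path, the backward extension and the route
-- from `y` to `v` without its end `v`; here q = 3 + r.
cycle-length : ∀ {i c} r → i + c ≡ 6 → suc (i + (2 + 3 * r + c)) ≡ 3 * (3 + r)
cycle-length {i} {c} r i+c≡6 = begin
  suc (i + (2 + 3 * r + c))   ≡⟨ solve (i ∷ c ∷ r ∷ []) ⟩
  3 + 3 * r + (i + c)         ≡⟨ cong (3 + 3 * r +_) i+c≡6 ⟩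
  3 + 3 * r + 6               ≡⟨ solve (r ∷ []) ⟩
  3 * (3 + r)                 ∎
  where open ≡-Reasoning

-- The bound 45q - 60 is 15(3q - 4), and 3q - 4 = 5 + 3r.
15f≤n : ∀ {n} r → 45 * (3 + r) ∸ 60 ≤ n → 15 * (5 + 3 * r) ≤ n
15f≤n {n} r = subst (_≤ n) (begin
  45 * (3 + r) ∸ 60       ≡⟨ cong (_∸ 60) (*-distribˡ-+ 45 3 r) ⟩
  75 + 45 * r             ≡⟨ cong (75 +_) (*-assoc 15 3 r) ⟩
  75 + 15 * (3 * r)       ≡⟨ sym (*-distribˡ-+ 15 5 (3 * r)) ⟩
  15 * (5 + 3 * r)        ∎)
  where open ≡-Reasoning

-- Counting

-- Constructors named like those of List are imported only here, because the
-- ring solver above needs unambiguous lists of variables.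
open import Data.List.Relation.Binary.Sublist.Propositional
  using ([]; _∷_; _∷ʳ_; ⊆-refl) renaming (_⊆_ to _⊑_; lookup to ⊑-lookup)
open import Data.List.Relation.Binary.Sublist.Propositional.Properties using (All-resp-⊆; ++⁺)
open import Data.List.Relation.Unary.All as All using (All; []; _∷_)
open import Data.List.Relation.Unary.All.Properties using (¬Any⇒All¬)
open import Data.List.Relation.Unary.Any using (here; there)
open import Data.List.Relation.Unary.Unique.Propositional using (Unique; []; _∷_)
import Data.List.Relation.Unary.Unique.Propositional.Properties as Unique

module _ {n : ℕ} where
  open DecMembership (_≟_ {n}) public using (_∈?_)

private variable
  n : ℕ
  X Y : Set
  xs ys : List X
  P Q R S K : Pred (Fin n) 0ℓ

⟦_⟧ : Dec X → ℕ
⟦ yes _ ⟧ = 1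
⟦ no  _ ⟧ = 0

⟦_⟧≤1 : (x : Dec X) → ⟦ x ⟧ ≤ 1
⟦ yes _ ⟧≤1 = s≤s z≤n
⟦ no  _ ⟧≤1 = z≤n

⟦⟧-mono : (x : Dec X) (y : Dec Y) → (X → Y) → ⟦ x ⟧ ≤ ⟦ y ⟧
⟦⟧-mono (no _)  _       _   = z≤n
⟦⟧-mono (yes _) (yes _) _   = s≤s z≤n
⟦⟧-mono (yes x) (no ¬y) x⇒y = contradiction (x⇒y x) ¬y

⟦⟧≡0 : (x : Dec X) → ¬ X → ⟦ x ⟧ ≡ 0
⟦⟧≡0 (yes x) ¬x = contradiction x ¬x
⟦⟧≡0 (no _)  _  = refl

∑-mono : ∀ {n} {f g : Fin n → ℕ} → (∀ i → f i ≤ g i) → ∑ f ≤ ∑ g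
∑-mono {zero}  f≤g = z≤n
∑-mono {suc n} f≤g = +-mono-≤ (f≤g zero) (∑-mono (f≤g ∘ suc))

-- A sum of indicators instead of the length of a filtered list: double counting becomes an exchange
-- of sums.
# : Decidable P → ℕ
# P? = ∑ λ i → ⟦ P? i ⟧

#-cover : (P? : Decidable P) (Q? : Decidable Q) (R? : Decidable R) →
          P ⊆ Q ∪ R → # P? ≤ # Q? + # R?
#-cover P? Q? R? P⊆Q∪R =
  ≤-trans (∑-mono pointwise) (≤-reflexive (∑-distrib-+ (λ i → ⟦ Q? i ⟧) λ i → ⟦ R? i ⟧))
  where
  pointwise : ∀ i → ⟦ P? i ⟧ ≤ ⟦ Q? i ⟧ + ⟦ R? i ⟧
  pointwise i with P? i | Q? i | R? i
  ... | no _  | _     | _     = z≤n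
  ... | yes _ | yes _ | _     = s≤s z≤n
  ... | yes _ | no _  | yes _ = s≤s z≤n
  ... | yes p | no ¬q | no ¬r = contradiction (P⊆Q∪R p) [ ¬q , ¬r ]′

#-disjoint : (P? : Decidable P) (Q? : Decidable Q) (R? : Decidable R) →
             P ⊆ R → Q ⊆ R → (∀ {i} → P i → ¬ Q i) → # P? + # Q? ≤ # R?
#-disjoint P? Q? R? P⊆R Q⊆R P⊥Q =
  ≤-trans (≤-reflexive (sym (∑-distrib-+ (λ i → ⟦ P? i ⟧) λ i → ⟦ Q? i ⟧))) (∑-mono pointwise)
  where
  pointwise : ∀ i → ⟦ P? i ⟧ + ⟦ Q? i ⟧ ≤ ⟦ R? i ⟧
  pointwise i with P? i | Q? i | R? i
  ... | yes p | yes q | _     = contradiction q (P⊥Q p)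
  ... | yes p | no _  | yes _ = s≤s z≤n
  ... | yes p | no _  | no ¬r = contradiction (P⊆R p) ¬r
  ... | no _  | yes q | yes _ = s≤s z≤n
  ... | no _  | yes q | no ¬r = contradiction (Q⊆R q) ¬r
  ... | no _  | no _  | _     = z≤n

#-mono : (P? : Decidable P) (Q? : Decidable Q) → P ⊆ Q → # P? ≤ # Q?
#-mono P? Q? P⊆Q = ∑-mono λ i → ⟦⟧-mono (P? i) (Q? i) P⊆Q

∪-∖ : (Q? : Decidable Q) → P ⊆ Q ∪ (P ∩ ∁ Q)
∪-∖ Q? {i} p with Q? i
... | yes q = inj₁ q
... | no ¬q = inj₂ (p , ¬q)

#-split : (P? : Decidable P) (Q? : Decidable Q) → # P? ≤ # Q? + # (P? ∩? ∁? Q?)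
#-split {P = P} P? Q? = #-cover P? Q? (P? ∩? ∁? Q?) (∪-∖ {P = P} Q?)

#-∖ : (P? : Decidable P) (Q? : Decidable Q) → Q ⊆ P → # Q? + # (P? ∩? ∁? Q?) ≤ # P?
#-∖ P? Q? Q⊆P = #-disjoint Q? (P? ∩? ∁? Q?) P? Q⊆P proj₁ (λ q (_ , ¬q) → ¬q q)

0<#⇒∃ : (P? : Decidable P) → 0 < # P? → ∃ P
0<#⇒∃ {suc n} P? 0<# with P? zero
... | yes p = zero , p
... | no _  with i , p ← 0<#⇒∃ (P? ∘ suc) 0<# = suc i , p

∃⇒0<# : (P? : Decidable P) → ∃ P → 0 < # P?
∃⇒0<# P? (zero , p) with P? zero
... | yes _ = s≤s z≤n
... | no ¬p = contradiction p ¬p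
∃⇒0<# P? (suc i , p) = ≤-trans (∃⇒0<# (P? ∘ suc) (i , p)) (m≤n+m _ _)

#-≤ : (P? : Decidable {A = Fin n} P) → # P? ≤ n
#-≤ {zero}  P? = z≤n
#-≤ {suc n} P? = +-mono-≤ ⟦ P? zero ⟧≤1 (#-≤ (P? ∘ suc))

#-none : (P? : Decidable {A = Fin n} P) → (∀ i → ¬ P i) → # P? ≡ 0
#-none {zero}  P? ¬P = refl
#-none {suc n} P? ¬P = cong₂ _+_ (⟦⟧≡0 (P? zero) (¬P zero)) (#-none (P? ∘ suc) (¬P ∘ suc))

#-singleton : (v : Fin n) (P? : Decidable P) → P ⊆ (_≡ v) → # P? ≡ ⟦ P? v ⟧
#-singleton zero    P? P⊆ = trans
  (cong (⟦ P? zero ⟧ +_) (#-none (P? ∘ suc) λ i p → contradiction (P⊆ p) λ ())) (+-identityʳ _)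
#-singleton (suc v) P? P⊆ = cong₂ _+_
  (⟦⟧≡0 (P? zero) λ p → contradiction (P⊆ p) λ ())
  (#-singleton v (P? ∘ suc) λ p → suc-injective (P⊆ p))

length-filter-tabulate : {A : Set} {P : Pred A 0ℓ} (P? : Decidable P) (f : Fin n → A) →
                         length (filter P? (tabulate f)) ≡ # (P? ∘ f)
length-filter-tabulate {zero}  P? f = refl
length-filter-tabulate {suc n} P? f with P? (f zero)
... | yes _ = cong suc (length-filter-tabulate P? (f ∘ suc))
... | no _  = length-filter-tabulate P? (f ∘ suc)

-- Each entry is charged its own indicator rather than 1, because for `v` and `w` the exact value is
-- needed later: it vanishes when the arc in question is absent.
#-avoid : (P? : Decidable P) (xs : List (Fin n)) →
          # P? ≤ # (P? ∩? ∁? (_∈? xs)) + sum (map (λ x → ⟦ P? x ⟧) xs)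
#-avoid P? []       = ≤-trans (#-mono P? (P? ∩? ∁? (_∈? [])) λ p → p , λ ()) (m≤m+n _ 0)
#-avoid {P = P} P? (x ∷ xs) = begin
  # P?
    ≤⟨ #-avoid P? xs ⟩
  # (P? ∩? ∁? (_∈? xs)) + Σ
    ≤⟨ +-monoˡ-≤ Σ step ⟩
  # (P? ∩? ∁? (_∈? x ∷ xs)) + # (P? ∩? (_≟ x)) + Σ
    ≡⟨ +-assoc _ (# (P? ∩? (_≟ x))) Σ ⟩
  # (P? ∩? ∁? (_∈? x ∷ xs)) + (# (P? ∩? (_≟ x)) + Σ)
    ≤⟨ +-monoʳ-≤ (# (P? ∩? ∁? (_∈? x ∷ xs))) (+-monoˡ-≤ Σ at-x) ⟩
  # (P? ∩? ∁? (_∈? x ∷ xs)) + (⟦ P? x ⟧ + Σ)  ∎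
  where
  open ≤-Reasoning
  Σ = sum (map (λ x → ⟦ P? x ⟧) xs)

  split : ∀ {w} → P w → w ∉ xs → P w × w ∉ x ∷ xs ⊎ P w × w ≡ x
  split {w} p w∉ with w ≟ x
  ... | yes w≡x = inj₂ (p , w≡x)
  ... | no  w≢x = inj₁ (p , λ { (here w≡x) → w≢x w≡x ; (there w∈) → w∉ w∈ })

  step : # (P? ∩? ∁? (_∈? xs)) ≤ # (P? ∩? ∁? (_∈? x ∷ xs)) + # (P? ∩? (_≟ x))
  step = #-cover (P? ∩? ∁? (_∈? xs)) (P? ∩? ∁? (_∈? x ∷ xs)) (P? ∩? (_≟ x))
                 λ (p , w∉) → split p w∉

  at-x : # (P? ∩? (_≟ x)) ≤ ⟦ P? x ⟧
  at-x = ≤-trans (≤-reflexive (#-singleton x (P? ∩? (_≟ x)) proj₂))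
                (⟦⟧-mono ((P? ∩? (_≟ x)) x) (P? x) proj₁)

sum-⟦⟧≤length : (P? : Decidable P) (xs : List (Fin n)) → sum (map (λ x → ⟦ P? x ⟧) xs) ≤ length xs
sum-⟦⟧≤length P? []       = z≤n
sum-⟦⟧≤length P? (x ∷ xs) = +-mono-≤ ⟦ P? x ⟧≤1 (sum-⟦⟧≤length P? xs)

#∉+length≤ : {xs : List (Fin n)} → Unique xs → # (∁? (_∈? xs)) + length xs ≤ n
#∉+length≤ {xs = []}     []   = ≤-trans (≤-reflexive (+-identityʳ _)) (#-≤ (∁? (_∈? [])))
#∉+length≤ {n} {x ∷ xs} u@(_ ∷ us) = begin
  # (∁? (_∈? x ∷ xs)) + suc (length xs)   ≡⟨ +-suc _ _ ⟩
  suc (# (∁? (_∈? x ∷ xs))) + length xs   ≤⟨ +-monoˡ-≤ (length xs) drop-x ⟩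
  # (∁? (_∈? xs)) + length xs             ≤⟨ #∉+length≤ us ⟩
  n                                       ∎
  where
  open ≤-Reasoning
  drop-x : suc (# (∁? (_∈? x ∷ xs))) ≤ # (∁? (_∈? xs))
  drop-x = ≤-trans (+-monoˡ-≤ _ (∃⇒0<# (_≟ x) (x , refl)))
    (#-disjoint (_≟ x) (∁? (_∈? x ∷ xs)) (∁? (_∈? xs))
      (λ { refl → Unique.Unique[x∷xs]⇒x∉xs u })
      (λ w∉ w∈ → w∉ (there w∈)) (λ w≡x w∉ → w∉ (here w≡x)))

∑∑-distrib-+ : (f g : Fin n → Fin n → ℕ) →
               ∑ (λ u → ∑ λ w → f u w + g u w) ≡ ∑ (λ u → ∑ (f u)) + ∑ (λ u → ∑ (g u))
∑∑-distrib-+ f g = trans (sum-cong-≋ λ u → ∑-distrib-+ (f u) (g u))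
                         (∑-distrib-+ (λ u → ∑ (f u)) λ u → ∑ (g u))

module _ (G : OrientedGraph n) where
  open OrientedGraph G

  -- Each unordered pair in S carries at most one arc, and the diagonal none.
  arcs-within : (S? : Decidable S) →
    2 * ∑ (λ u → ⟦ S? u ⟧ * # ((u ⟶?_) ∩? S?)) + # S? ≤ # S? * # S?
  arcs-within S? = begin
    2 * E + # S?
      ≡⟨ cong₂ (λ x y → 2 * x + y) E≡ (sum-cong-≋ λ u → sym (diagonal u)) ⟩
    2 * ∑ (λ u → ∑ (f u)) + ∑ (λ u → ∑ (δ u))
      ≡⟨ cong (λ x → ∑ (λ u → ∑ (f u)) + x + ∑ (λ u → ∑ (δ u)))
              (trans (+-identityʳ _) (∑-comm f)) ⟩
    ∑ (λ u → ∑ (f u)) + ∑ (λ w → ∑ λ u → f u w) + ∑ (λ u → ∑ (δ u))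
      ≡⟨ cong (_+ ∑ (λ u → ∑ (δ u))) (sym (∑∑-distrib-+ f λ w u → f u w)) ⟩
    ∑ (λ u → ∑ λ w → f u w + f w u) + ∑ (λ u → ∑ (δ u))
      ≡⟨ sym (∑∑-distrib-+ (λ u w → f u w + f w u) δ) ⟩
    ∑ (λ u → ∑ λ w → f u w + f w u + δ u w)
      ≤⟨ ∑-mono (λ u → ∑-mono (pointwise u)) ⟩
    ∑ (λ u → ∑ λ w → ⟦ S? u ⟧ * ⟦ S? w ⟧)
      ≡⟨ sum-cong-≋ (λ u → sym (*-distribˡ-sum ⟦ S? u ⟧ λ w → ⟦ S? w ⟧)) ⟩
    ∑ (λ u → ⟦ S? u ⟧ * # S?)
      ≡⟨ sym (*-distribʳ-sum (# S?) λ u → ⟦ S? u ⟧) ⟩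
    # S? * # S?  ∎
    where
    open ≤-Reasoning
    E = ∑ λ u → ⟦ S? u ⟧ * # ((u ⟶?_) ∩? S?)
    f δ : Fin _ → Fin _ → ℕ
    f u w = ⟦ S? u ⟧ * ⟦ ((u ⟶?_) ∩? S?) w ⟧
    -- The diagonal of S × S, which carries no arc; this is worth the extra summand `# S?`.
    δ u w = ⟦ (S? ∩? (_≟ u)) w ⟧

    E≡ : E ≡ ∑ λ u → ∑ (f u)
    E≡ = sum-cong-≋ λ u → *-distribˡ-sum ⟦ S? u ⟧ λ w → ⟦ ((u ⟶?_) ∩? S?) w ⟧

    diagonal : ∀ u → # (S? ∩? (_≟ u)) ≡ ⟦ S? u ⟧
    diagonal u = trans (#-singleton u (S? ∩? (_≟ u)) proj₂)
      (≤-antisym (⟦⟧-mono ((S? ∩? (_≟ u)) u) (S? u) proj₁)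
                 (⟦⟧-mono (S? u) ((S? ∩? (_≟ u)) u) λ Su → Su , refl))

    pointwise : ∀ u w → f u w + f w u + δ u w ≤ ⟦ S? u ⟧ * ⟦ S? w ⟧
    pointwise u w with S? u | S? w | u ⟶? w | w ⟶? u | w ≟ u
    ... | yes _ | yes _ | yes p | yes q | _        = contradiction q (asym p)
    ... | yes _ | yes _ | yes p | no _  | yes refl = contradiction p (asym p)
    ... | yes _ | yes _ | no _  | yes q | yes refl = contradiction q (asym q)
    ... | yes _ | yes _ | yes _ | no _  | no _     = s≤s z≤n
    ... | yes _ | yes _ | no _  | yes _ | no _     = s≤s z≤n
    ... | yes _ | yes _ | no _  | no _  | yes _    = s≤s z≤n
    ... | yes _ | yes _ | no _  | no _  | no _     = z≤n
    ... | yes Su | no ¬S | yes _ | yes _ | yes refl = contradiction Su ¬S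
    ... | yes Su | no ¬S | yes _ | no _  | yes refl = contradiction Su ¬S
    ... | yes Su | no ¬S | no _  | yes _ | yes refl = contradiction Su ¬S
    ... | yes Su | no ¬S | no _  | no _  | yes refl = contradiction Su ¬S
    ... | yes _ | no _ | yes _ | yes _ | no _ = z≤n
    ... | yes _ | no _ | yes _ | no _  | no _ = z≤n
    ... | yes _ | no _ | no _  | yes _ | no _ = z≤n
    ... | yes _ | no _ | no _  | no _  | no _ = z≤n
    ... | no ¬S | yes Su | _ | yes _ | yes refl = contradiction Su ¬S
    ... | no ¬S | yes Su | _ | no _  | yes refl = contradiction Su ¬S
    ... | no _ | yes _ | _ | yes _ | no _ = z≤n
    ... | no _ | yes _ | _ | no _  | no _ = z≤n
    ... | no _ | no _ | _ | _ | _ = z≤n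

  -- Summed over `S`, the hypothesis bounds `# S? * d` by the number of arcs inside `S` plus `r` for
  -- each vertex of `K`. Twice the first term is then bounded by `arcs-within`.
  degree-count : (S? : Decidable S) (K? : Decidable K) (d r : ℕ) →
    (∀ u → S u → d ≤ # ((u ⟶?_) ∩? S?) + ⟦ K? u ⟧ * r) →
    2 * (# S? * d) + # S? ≤ # S? * # S? + 2 * (# K? * r)
  degree-count {S} S? K? d r d≤ = begin
    2 * (# S? * d) + # S?             ≤⟨ +-monoˡ-≤ (# S?) (*-monoʳ-≤ 2 total) ⟩
    2 * (E + # K? * r) + # S?         ≡⟨ rearrange E (# K? * r) (# S?) ⟩
    2 * E + # S? + 2 * (# K? * r)     ≤⟨ +-monoˡ-≤ _ (arcs-within S?) ⟩
    # S? * # S? + 2 * (# K? * r)      ∎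
    where
    open ≤-Reasoning
    E = ∑ λ u → ⟦ S? u ⟧ * # ((u ⟶?_) ∩? S?)

    rearrange : ∀ e k s → 2 * (e + k) + s ≡ 2 * e + s + 2 * k
    rearrange = solve-∀

    pointwise : ∀ u → ⟦ S? u ⟧ * d ≤ ⟦ S? u ⟧ * # ((u ⟶?_) ∩? S?) + ⟦ K? u ⟧ * r
    pointwise u with S? u
    ... | no _   = z≤n
    ... | yes Su rewrite *-identityˡ d | *-identityˡ (# ((u ⟶?_) ∩? S?)) = d≤ u Su

    total : # S? * d ≤ E + # K? * r
    total = begin
      # S? * d
        ≡⟨ *-distribʳ-sum d (λ u → ⟦ S? u ⟧) ⟩
      ∑ (λ u → ⟦ S? u ⟧ * d)
        ≤⟨ ∑-mono pointwise ⟩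
      ∑ (λ u → ⟦ S? u ⟧ * # ((u ⟶?_) ∩? S?) + ⟦ K? u ⟧ * r)
        ≡⟨ ∑-distrib-+ (λ u → ⟦ S? u ⟧ * # ((u ⟶?_) ∩? S?)) (λ u → ⟦ K? u ⟧ * r) ⟩
      E + ∑ (λ u → ⟦ K? u ⟧ * r)
        ≡⟨ cong (E +_) (sym (*-distribʳ-sum r λ u → ⟦ K? u ⟧)) ⟩
      E + # K? * r ∎

-- Connecting paths

reverse : OrientedGraph n → OrientedGraph n
reverse G = record { _⟶_ = λ u w → w ⟶ u ; _⟶?_ = λ u w → w ⟶? u ; asym = asym }
  where open OrientedGraph G

-- W is meant to exclude s and t, so arcs to and from them are counted separately.
record Separated (G : OrientedGraph n) {W : Pred (Fin n) 0ℓ} (W? : Decidable W)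
                 (s t : Fin n) (d : ℕ) : Set where
  open OrientedGraph G
  field
    out-degree : ∀ u → d ≤ # ((u ⟶?_) ∩? W?) + (⟦ u ⟶? s ⟧ + ⟦ u ⟶? t ⟧)
    in-degree  : ∀ u → d ≤ # ((_⟶? u) ∩? W?) + (⟦ t ⟶? u ⟧ + ⟦ s ⟶? u ⟧)
    no-path₃ : ∀ {a b} → W a → W b → s ⟶ a → a ⟶ b → ¬ b ⟶ t
    no-path₄ : ∀ {a c b} → W a → W c → W b → s ⟶ a → a ⟶ c → c ⟶ b → ¬ b ⟶ t
    no-path₅ : ∀ {a c e b} → W a → W c → W e → W b → a ≢ b →
               s ⟶ a → a ⟶ c → c ⟶ e → e ⟶ b → ¬ b ⟶ t

module _ {G : OrientedGraph n} {W : Pred (Fin n) 0ℓ} {W? : Decidable W} {s t : Fin n} {d : ℕ} where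

  -- The indicators in `in-degree` are listed with `t` first, so that reversing the arcs exchanges
  -- the two degree bounds definitionally.
  Separated-reverse : Separated G W? s t d → Separated (reverse G) W? t s d
  Separated-reverse sep = record
    { out-degree = in-degree
    ; in-degree  = out-degree
    ; no-path₃   = λ a b p q r → no-path₃ b a r q p
    ; no-path₄   = λ a c b p q r v → no-path₄ b c a v r q p
    ; no-path₅   = λ a c e b a≢b p q r v w → no-path₅ b e c a (a≢b ∘ sym) w v r q p
    }
    where open Separated sep

-- Private is A ∖ B and Near is S; for the reverse graph they are B ∖ A and T.
module Side (G : OrientedGraph n) {W : Pred (Fin n) 0ℓ} (W? : Decidable W) (s t : Fin n) where
  open OrientedGraph G

  Private Near : Pred (Fin n) 0ℓ
  Private a = (s ⟶ a × W a) × ¬ a ⟶ t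
  Near c = Private c ⊎ W c × ∃[ a ] Private a × a ⟶ c

  Near⊆W : Near ⊆ W
  Near⊆W (inj₁ ((_ , Ww) , _)) = Ww
  Near⊆W (inj₂ (Ww , _))       = Ww

  Private? : Decidable Private
  Private? a = ((s ⟶? a) ×-dec W? a) ×-dec ¬? (a ⟶? t)

  Near? : Decidable Near
  Near? c = Private? c ⊎-dec (W? c ×-dec any? λ a → Private? a ×-dec (a ⟶? c))

module _ {G : OrientedGraph n} {W : Pred (Fin n) 0ℓ} {W? : Decidable W} {s t : Fin n} {d : ℕ}
         (sep : Separated G W? s t d) where
  open OrientedGraph G
  open Separated sep

  out-degree-no-t : ∀ {u} → ¬ u ⟶ t → d ≤ # ((u ⟶?_) ∩? W?) + 1
  out-degree-no-t {u} ¬ut = ≤-trans (out-degree u) (+-monoʳ-≤ _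
    (≤-trans (≤-reflexive (trans (cong (⟦ u ⟶? s ⟧ +_) (⟦⟧≡0 (u ⟶? t) ¬ut)) (+-identityʳ _)))
             ⟦ u ⟶? s ⟧≤1))

  out-degree-no-s : ∀ {u} → ¬ u ⟶ s → d ≤ # ((u ⟶?_) ∩? W?) + 1
  out-degree-no-s {u} ¬us = ≤-trans (out-degree u) (+-monoʳ-≤ _
    (≤-trans (≤-reflexive (cong (_+ ⟦ u ⟶? t ⟧) (⟦⟧≡0 (u ⟶? s) ¬us))) ⟦ u ⟶? t ⟧≤1))

  out-degree-no-s,t : ∀ {u} → ¬ u ⟶ s → ¬ u ⟶ t → d ≤ # ((u ⟶?_) ∩? W?)
  out-degree-no-s,t {u} ¬us ¬ut = ≤-trans (out-degree u) (≤-reflexive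
    (trans
    (cong₂ (λ x y → # ((u ⟶?_) ∩? W?) + (x + y)) (⟦⟧≡0 (u ⟶? s) ¬us) (⟦⟧≡0 (u ⟶? t) ¬ut))
    (+-identityʳ _)))

  -- The 1 in `# R? + 1` allows for an arc to `s`. The factor `1 *` is what the indicator in
  -- `degree-count` becomes at a vertex of the exceptional set.
  out-degree-within : {S R : Pred (Fin n) 0ℓ} (S? : Decidable S) (R? : Decidable R) →
    ∀ {u} → ¬ u ⟶ t →
    (∀ {w} → u ⟶ w → W w → ¬ S w → R w) → d ≤ # ((u ⟶?_) ∩? S?) + 1 * (# R? + 1)
  out-degree-within S? R? {u} ¬ut W∖S⊆R = begin
    d
      ≤⟨ out-degree-no-t ¬ut ⟩
    # ((u ⟶?_) ∩? W?) + 1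
      ≤⟨ +-monoˡ-≤ 1 (#-cover ((u ⟶?_) ∩? W?) ((u ⟶?_) ∩? S?) R? cover) ⟩
    # ((u ⟶?_) ∩? S?) + # R? + 1
      ≡⟨ +-assoc (# ((u ⟶?_) ∩? S?)) (# R?) 1 ⟩
    # ((u ⟶?_) ∩? S?) + (# R? + 1)
      ≡⟨ cong (# ((u ⟶?_) ∩? S?) +_) (sym (+-identityʳ (# R? + 1))) ⟩
    # ((u ⟶?_) ∩? S?) + 1 * (# R? + 1)  ∎
    where
    open ≤-Reasoning
    cover : ∀ {w} → u ⟶ w × W w → _
    cover {w} (uw , Ww) with S? w
    ... | yes Sw = inj₁ (uw , Sw)
    ... | no ¬Sw = inj₂ (W∖S⊆R uw Ww ¬Sw)

  loopless : ∀ {u} → ¬ u ⟶ u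
  loopless uu = asym uu uu

  s-out-degree : d ≤ # ((s ⟶?_) ∩? W?) + 1
  s-out-degree = out-degree-no-s loopless

module _ {G : OrientedGraph n} {W : Pred (Fin n) 0ℓ} {W? : Decidable W} {s t : Fin n} {d : ℕ}
         (sep : Separated G W? s t d) (2#W+7≤7d : 2 * # W? + 7 ≤ 7 * d) (3≤d : 3 ≤ d) where
  open OrientedGraph G
  open Separated sep
  private module Forward = Side G W? s t
  private module Backward = Side (reverse G) W? t s

  -- Here all members of `A` send arcs to `t`. An arc from a vertex of `S` into `W` therefore misses
  -- `A` by `no-path₄`, and it misses `T` by `no-path₅`, for which `a` and `b` must differ. So `R`
  -- receives every arc into `W` that leaves `S`.
  nested-impossible : (∀ {a} → s ⟶ a → W a → a ⟶ t) → ⊥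
  nested-impossible A⊆B = two-neighbours (0<#⇒∃ A? 0<#A)
    where
    A? = (s ⟶?_) ∩? W?

    -- Beyond the arcs into `W`, only one to `t` can count towards the `d` out-arcs of `s`, so at
    -- least two members of `A` remain.
    2≤#A : 2 ≤ # A?
    2≤#A = +-cancelʳ-≤ 1 2 _ (≤-trans 3≤d (s-out-degree sep))

    0<#A : 0 < # A?
    0<#A = ≤-trans (s≤s z≤n) 2≤#A

    two-neighbours : ∃ (λ a → s ⟶ a × W a) → ⊥
    two-neighbours (a , sa , Wa)
      with b , (sb , Wb) , b≢a ← 0<#⇒∃ (A? ∩? ∁? (_≟ a)) (+-cancelˡ-≤ 1 1 _ (≤-trans 2≤#A
             (≤-trans (#-split A? (_≟ a))
                      (+-monoˡ-≤ _ (≤-trans (≤-reflexive (#-singleton a (_≟ a) id)) ⟦ a ≟ a ⟧≤1)))))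
      = one-sided-gap
          (out-degree-no-s sep (asym sa)) (out-degree-no-s (Separated-reverse sep) (asym bt))
          (s-out-degree sep) 0<#S count total 2#W+7≤7d
      where
      bt = A⊆B sb Wb
      S? = (a ⟶?_) ∩? W?
      T? = (_⟶? b) ∩? W?
      R₁? = W? ∩? ∁? S?
      R₂? = R₁? ∩? ∁? T?
      R?  = R₂? ∩? ∁? A?

      0<#S : 0 < # S?
      0<#S = +-cancelʳ-≤ 1 1 _
        (≤-trans (≤-trans (s≤s (s≤s z≤n)) 3≤d) (out-degree-no-s sep (asym sa)))

      total : # S? + (# T? + (# A? + # R?)) ≤ # W?
      total = ≤-trans (+-monoʳ-≤ (# S?) (≤-trans (+-monoʳ-≤ (# T?)
        (#-∖ R₂? A? λ (sw , Ww) → (Ww , λ (aw , _) → no-path₃ Wa Ww sa aw (A⊆B sw Ww))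
                                , λ (wb , _) → no-path₃ Ww Wb sw wb bt))
        (#-∖ R₁? T? λ (wb , Ww) → Ww , λ (aw , _) → no-path₄ Wa Ww Wb sa aw wb bt)))
        (#-∖ W? S? proj₂)

      count : 2 * (# S? * d) + # S? ≤ # S? * # S? + 2 * (# S? * (# R? + 1))
      count = degree-count G S? S? d (# R? + 1) λ u Su → bound u Su
        where
        bound : ∀ u → a ⟶ u × W u → d ≤ # ((u ⟶?_) ∩? S?) + ⟦ S? u ⟧ * (# R? + 1)
        bound u (au , Wu) with S? u
        ... | no ¬S = contradiction (au , Wu) ¬S
        ... | yes _ = out-degree-within sep S? R? (no-path₃ Wa Wu sa au) λ uw Ww ¬Sw →
          ((Ww , ¬Sw) , λ (wb , _) → no-path₅ Wa Wu Ww Wb (b≢a ∘ sym) sa au uw wb bt) ,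
          λ (sw , _) → no-path₄ Wa Wu Ww sa au uw (A⊆B sw Ww)

  -- There are two counts: `inner` over `Private`, whose arcs into `W` end in `Private` or `K`, and
  -- `outer` over `S`, where only vertices of `K` can reach `R`. The comparison with the other side
  -- limits the room left for `R`.
  unbalanced-impossible : ∃ Forward.Private → # Forward.Near? ≤ # Backward.Near? → ⊥
  unbalanced-impossible nonempty S≤T =
    two-sided-gap {i = # I?} {# R?} (∃⇒0<# P? nonempty) inner outer
      (#-split S? P?) (#-∖ S? P? inj₁) S≤T
      (≤-trans (s-out-degree sep) (+-monoˡ-≤ 1 (#-cover ((s ⟶?_) ∩? W?) P? I? λ {w} → split-A w)))
      total 2#W+7≤7d
    where
    open Forward using (Private; Near)
    P? = Forward.Private?
    S? = Forward.Near?
    T? = Backward.Near?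
    K? = S? ∩? ∁? P?
    I? : Decidable λ w → (s ⟶ w × W w) × w ⟶ t
    I? w = ((s ⟶? w) ×-dec W? w) ×-dec (w ⟶? t)
    R₁? = W? ∩? ∁? S?
    R₂? = R₁? ∩? ∁? T?
    R?  = R₂? ∩? ∁? I?

    split-A : ∀ w → s ⟶ w × W w → Private w ⊎ (s ⟶ w × W w) × w ⟶ t
    split-A w sw with w ⟶? t
    ... | yes wt = inj₂ (sw , wt)
    ... | no ¬wt = inj₁ (sw , ¬wt)

    near-misses-t : ∀ {w} → Near w → ¬ w ⟶ t
    near-misses-t (inj₁ (_ , ¬wt)) = ¬wt
    near-misses-t (inj₂ (Ww , a , ((sa , Wa) , _) , aw)) = no-path₃ Wa Ww sa aw

    near-far-disjoint : ∀ {w} → Near w → ¬ Backward.Near w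
    near-far-disjoint Sw (inj₁ ((wt , _) , _)) = near-misses-t Sw wt
    near-far-disjoint (inj₁ ((sw , Ww) , _)) (inj₂ (_ , b , ((bt , Wb) , _) , wb)) =
      no-path₃ Ww Wb sw wb bt
    near-far-disjoint (inj₂ (Ww , a , ((sa , Wa) , _) , aw)) (inj₂ (_ , b , ((bt , Wb) , _) , wb)) =
      no-path₄ Wa Ww Wb sa aw wb bt

    far-misses-s : ∀ {w} → Backward.Near w → ¬ s ⟶ w
    far-misses-s (inj₁ (_ , ¬sw)) = ¬sw
    far-misses-s (inj₂ (Ww , b , ((bt , Wb) , _) , wb)) sw = no-path₃ Ww Wb sw wb bt

    total : # S? + (# T? + (# I? + # R?)) ≤ # W?
    total = ≤-trans (+-monoʳ-≤ (# S?) (≤-trans (+-monoʳ-≤ (# T?)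
      (#-∖ R₂? I? λ ((sw , Ww) , wt) →
        (Ww , λ Sw → near-misses-t Sw wt) , λ Tw → far-misses-s Tw sw))
      (#-∖ R₁? T? λ Tw → Backward.Near⊆W Tw , λ Sw → near-far-disjoint Sw Tw)))
      (#-∖ W? S? Forward.Near⊆W)

    private-out-degree : ∀ {u} → Private u → d ≤ # ((u ⟶?_) ∩? S?)
    private-out-degree {u} Pu@((su , _) , ¬ut) = ≤-trans (out-degree-no-s,t sep (asym su) ¬ut)
      (#-mono ((u ⟶?_) ∩? W?) ((u ⟶?_) ∩? S?) λ (uw , Ww) → uw , inj₂ (Ww , u , Pu , uw))

    inner : 2 * (# P? * d) + # P? ≤ # P? * # P? + 2 * (# P? * # K?)
    inner = degree-count G P? P? d (# K?) bound
      where
      bound : ∀ u → Private u → d ≤ # ((u ⟶?_) ∩? P?) + ⟦ P? u ⟧ * # K?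
      bound u Pu with P? u
      ... | no ¬Pu = contradiction Pu ¬Pu
      ... | yes _  = ≤-trans (private-out-degree Pu) (≤-trans
        (#-cover ((u ⟶?_) ∩? S?) ((u ⟶?_) ∩? P?) K? λ {w} (uw , Sw) →
          [ (λ Pw → inj₁ (uw , Pw)) , inj₂ ]′ (∪-∖ {P = Near} P? Sw))
        (≤-reflexive (cong (# ((u ⟶?_) ∩? P?) +_) (sym (+-identityʳ _)))))

    outer : 2 * (# S? * d) + # S? ≤ # S? * # S? + 2 * (# K? * (# R? + 1))
    outer = degree-count G S? K? d (# R? + 1) bound
      where
      bound : ∀ u → Near u → d ≤ # ((u ⟶?_) ∩? S?) + ⟦ K? u ⟧ * (# R? + 1)
      bound u (inj₁ Pu) = ≤-trans (private-out-degree Pu) (m≤m+n _ _)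
      bound u Su@(inj₂ (Wu , a , ((sa , Wa) , ¬at) , au)) with K? u
      ... | no ¬Ku = ≤-trans
        (private-out-degree (decidable-stable (P? u) λ ¬Pu → ¬Ku (Su , ¬Pu))) (m≤m+n _ _)
      ... | yes _ = out-degree-within sep S? R? (near-misses-t Su) λ uw Ww ¬Sw →
        ((Ww , ¬Sw) , ¬Tw uw Ww) , λ (_ , wt) → no-path₄ Wa Wu Ww sa au uw wt
        where
        ¬Tw : ∀ {w} → u ⟶ w → W w → ¬ Backward.Near w
        ¬Tw uw Ww (inj₁ ((wt , _) , _)) = no-path₄ Wa Wu Ww sa au uw wt
        ¬Tw uw Ww (inj₂ (_ , b , ((bt , Wb) , ¬sb) , wb)) =
          no-path₅ Wa Wu Ww Wb (λ { refl → ¬sb sa }) sa au uw wb bt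

-- Reversing the arcs exchanges A and B, hence also S and T, which settles the second nested case
-- and the comparison |T| ≤ |S|.
¬Separated : {G : OrientedGraph n} {W : Pred (Fin n) 0ℓ} {W? : Decidable W} {s t : Fin n} {d : ℕ} →
  2 * # W? + 7 ≤ 7 * d → 3 ≤ d → ¬ Separated G W? s t d
¬Separated {G = G} {W? = W?} {s} {t} w≤ 3≤d sep
  with any? (Side.Private? G W? s t) | any? (Side.Private? (reverse G) W? t s)
... | no none | _ = nested-impossible sep w≤ 3≤d λ {a} sa Wa →
  decidable-stable (a ⟶? t) λ ¬at → none (a , (sa , Wa) , ¬at)
  where open OrientedGraph G
... | yes _ | no none = nested-impossible (Separated-reverse sep) w≤ 3≤d λ {b} bt Wb →
  decidable-stable (s ⟶? b) λ ¬sb → none (b , (bt , Wb) , ¬sb)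
  where open OrientedGraph G
... | yes p | yes q =
  [ unbalanced-impossible sep w≤ 3≤d p
  , unbalanced-impossible (Separated-reverse sep) w≤ 3≤d q ]′ (≤-total _ _)

-- Cycles

Unique-resp-⊑ : xs ⊑ ys → Unique ys → Unique xs
Unique-resp-⊑ []         []       = []
Unique-resp-⊑ (_ ∷ʳ p)   (_ ∷ u)  = Unique-resp-⊑ p u
Unique-resp-⊑ (refl ∷ p) (a ∷ u)  = All-resp-⊆ p a ∷ Unique-resp-⊑ p u

lookup-injective : Unique xs → ∀ {i j} → lookup xs i ≡ lookup xs j → i ≡ j
lookup-injective (_ ∷ _) {zero}  {zero}  _  = refl
lookup-injective (a ∷ _) {zero}  {suc j} eq = contradiction eq (All.lookup a (∈-lookup j))
lookup-injective (a ∷ _) {suc i} {zero}  eq = contradiction (sym eq) (All.lookup a (∈-lookup i))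
lookup-injective (_ ∷ u) {suc i} {suc j} eq = cong suc (lookup-injective u eq)

∉-∷ : {x : X} → x ∉ xs → Unique xs → Unique (x ∷ xs)
∉-∷ x∉ u = ¬Any⇒All¬ _ x∉ ∷ u

module _ (G : OrientedGraph n) where
  open OrientedGraph G

  -- The list holds the vertices of the walk in order, except the last one.
  data Walk : Fin n → List (Fin n) → Fin n → Set where
    []  : ∀ {u} → Walk u [] u
    _∷_ : ∀ {u w v xs} → u ⟶ w → Walk w xs v → Walk u (u ∷ xs) v

module _ {G : OrientedGraph n} where
  open OrientedGraph G

  infixr 5 _⧺_
  _⧺_ : ∀ {u w v xs ys} → Walk G u xs w → Walk G w ys v → Walk G u (xs ++ ys) v
  []       ⧺ q = q
  (uw ∷ p) ⧺ q = uw ∷ (p ⧺ q)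

  walk-step : ∀ {u v xs} → Walk G u xs v → (i j : Fin (length xs)) →
              toℕ j ≡ suc (toℕ i) → lookup xs i ⟶ lookup xs j
  walk-step (_  ∷ p)       (suc i) (suc j)    eq = walk-step p i j (cong (_∸ 1) eq)
  walk-step (uw ∷ (_ ∷ _)) zero    (suc zero) eq = uw

  walk-last : ∀ {u v xs} → Walk G u xs v → (i : Fin (length xs)) →
              suc (toℕ i) ≡ length xs → lookup xs i ⟶ v
  walk-last (uw ∷ [])           zero    eq = uw
  walk-last (_ ∷ p@(_ ∷ _))     (suc i) eq = walk-last p i (cong (_∸ 1) eq)

  closed-walk⇒cycle : ∀ {v xs ℓ} → Walk G v (v ∷ xs) v → Unique (v ∷ xs) → suc (length xs) ≡ ℓ →
                      Σ[ C ∈ DirectedCycle G ℓ ] LiesOn v C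
  closed-walk⇒cycle {v} {xs} p u refl = record
    { vertex    = lookup (v ∷ xs)
    ; injective = lookup-injective u
    ; arc       = arc
    } , zero , refl
    where
    toℕ-next : ∀ i → toℕ (next i) ≡ suc (toℕ i) % suc (length xs)
    toℕ-next i = toℕ-fromℕ< _

    arc : ∀ i → lookup (v ∷ xs) i ⟶ lookup (v ∷ xs) (next i)
    arc i with m≤n⇒m<n∨m≡n (toℕ<n i)
    ... | inj₁ i+1<ℓ = walk-step p i (next i) (trans (toℕ-next i) (m<n⇒m%n≡m i+1<ℓ))
    -- At the last index `next i` wraps around to `zero`, and the walk closes up at `v`.
    ... | inj₂ i+1≡ℓ = subst (λ j → lookup (v ∷ xs) i ⟶ lookup (v ∷ xs) j)
      (sym (toℕ-injective {j = zero} (trans (toℕ-next i)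
        (trans (cong (_% suc (length xs)) i+1≡ℓ) (n%n≡0 (suc (length xs)))))))
      (walk-last p i i+1≡ℓ)

-- Semidegrees, transitive triangles and greedy extension

module Degrees (G : OrientedGraph n) where
  open OrientedGraph G

  arc⇒≢ : ∀ {u w} → u ⟶ w → u ≢ w
  arc⇒≢ uw refl = asym uw uw

  path₂⇒≢ : ∀ {u w x} → u ⟶ w → w ⟶ x → u ≢ x
  path₂⇒≢ uw wx refl = asym uw wx

  δ⁰≤d⁺⊓d⁻ : ∀ v → δ⁰ ≤ d⁺ v ⊓ d⁻ v
  δ⁰≤d⁺⊓d⁻ v = All.lookup (min≤xs n (map (λ v → d⁺ v ⊓ d⁻ v) (allFin n))) (∈-map⁺ _ (∈-allFin v))

  δ⁰≤#out : ∀ v → δ⁰ ≤ # (v ⟶?_)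
  δ⁰≤#out v =
    ≤-trans (≤-trans (δ⁰≤d⁺⊓d⁻ v) (m⊓n≤m _ _)) (≤-reflexive (length-filter-tabulate (v ⟶?_) id))

  δ⁰≤#in : ∀ v → δ⁰ ≤ # (_⟶? v)
  δ⁰≤#in v =
    ≤-trans (≤-trans (δ⁰≤d⁺⊓d⁻ v) (m⊓n≤n _ _)) (≤-reflexive (length-filter-tabulate (_⟶? v) id))

  -- If the in-neighbourhood of v were independent, it would be disjoint from
  -- both neighbourhoods of any of its members.
  transitive-triangle : n < δ⁰ * 3 → ∀ v → ∃[ x ] ∃[ y ] x ⟶ y × x ⟶ v × y ⟶ v
  transitive-triangle n<3δ v with any? (λ x → any? λ y → (x ⟶? y) ×-dec (x ⟶? v) ×-dec (y ⟶? v))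
  ... | yes found = found
  ... | no ¬found = contradiction n<3δ (≤⇒≯ (begin
    δ⁰ * 3
      ≡⟨ trans (*-comm δ⁰ 3) (cong (λ x → δ⁰ + (δ⁰ + x)) (+-identityʳ δ⁰)) ⟩
    δ⁰ + (δ⁰ + δ⁰)
      ≤⟨ +-mono-≤ (δ⁰≤#in v) (+-mono-≤ (δ⁰≤#in a) (δ⁰≤#out a)) ⟩
    # (_⟶? v) + (# (_⟶? a) + # (a ⟶?_))
      ≤⟨ +-monoʳ-≤ (# (_⟶? v)) (#-disjoint (_⟶? a) (a ⟶?_) (∁? (_⟶? v))
           (λ xa xv → ¬found (_ , _ , xa , xv , av))
           (λ ax xv → ¬found (_ , _ , ax , av , xv)) asym) ⟩
    # (_⟶? v) + # (∁? (_⟶? v))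
      ≤⟨ #-disjoint (_⟶? v) (∁? (_⟶? v)) V? _ _ (λ xv ¬xv → ¬xv xv) ⟩
    # V?
      ≤⟨ #-≤ V? ⟩
    n ∎))
    where
    open ≤-Reasoning
    V? : Decidable {A = Fin n} U
    V? = U?
    0<δ : 0 < δ⁰
    0<δ with δ⁰
    ... | suc _ = s≤s z≤n
    ... | zero = contradiction n<3δ λ ()

    a,av = 0<#⇒∃ (_⟶? v) (≤-trans 0<δ (δ⁰≤#in v))
    a = proj₁ a,av
    av = proj₂ a,av

  fresh-in-neighbour : ∀ u xs → length xs < δ⁰ → ∃[ w ] w ⟶ u × w ∉ xs
  fresh-in-neighbour u xs <δ = 0<#⇒∃ ((_⟶? u) ∩? ∁? (_∈? xs)) (+-cancelʳ-≤ (length xs) 1 _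
    (≤-trans <δ (≤-trans (δ⁰≤#in u) (≤-trans (#-avoid (_⟶? u) xs)
      (+-monoʳ-≤ (# ((_⟶? u) ∩? ∁? (_∈? xs))) (sum-⟦⟧≤length (_⟶? u) xs))))))

  -- Each new vertex must avoid `v` as well as all vertices used so far; the `suc` in the bound
  -- counts `v`.
  extend-backwards : ∀ p {v y core} → Unique (y ∷ core) → v ∉ y ∷ core →
    suc (length (y ∷ core)) + p ≤ δ⁰ →
    ∃[ w ] ∃[ pre ] length pre ≡ p × Walk G w pre y × Unique (pre ++ y ∷ core) × v ∉ pre ++ y ∷ core
  extend-backwards zero    {y = y}        u v∉ _ = y , [] , refl , [] , u , v∉
  extend-backwards (suc p) {v} {y} {core} u v∉ p<δ
    with w , pre , refl , walk , u′ , v∉′ ← extend-backwards p u v∉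
           (≤-trans (+-monoʳ-≤ (suc (length (y ∷ core))) (n≤1+n p)) p<δ)
    with x , xw , x∉ ← fresh-in-neighbour w (v ∷ pre ++ y ∷ core) (≤-trans (≤-reflexive (trans
           (cong (2 +_) (trans (length-++ pre) (+-comm (length pre) (length (y ∷ core)))))
           (sym (cong suc (+-suc (length (y ∷ core)) (length pre)))))) p<δ)
    = x , x ∷ pre , refl , xw ∷ walk , ∉-∷ (x∉ ∘ there) u′ ,
      λ { (here v≡x) → x∉ (here (sym v≡x)) ; (there v∈) → v∉′ v∈ }

-- Closing the cycle

module _ (G : OrientedGraph n) {W : Pred (Fin n) 0ℓ} (W? : Decidable W) (s t : Fin n) where
  open OrientedGraph G

  -- In `Path₅` only `a` and `b` need to be kept apart: any other coincidence among interior
  -- vertices would give a loop or a pair of opposite arcs.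
  Path₃ Path₄ Path₅ : Set
  Path₃ = ∃[ a ] ∃[ b ] W a × W b × s ⟶ a × a ⟶ b × b ⟶ t
  Path₄ = ∃[ a ] ∃[ c ] ∃[ b ] W a × W c × W b × s ⟶ a × a ⟶ c × c ⟶ b × b ⟶ t
  Path₅ = ∃[ a ] ∃[ c ] ∃[ e ] ∃[ b ] W a × W c × W e × W b × a ≢ b ×
          s ⟶ a × a ⟶ c × c ⟶ e × e ⟶ b × b ⟶ t

  path₃? : Dec Path₃
  path₃? = any? λ a → any? λ b → W? a ×-dec W? b ×-dec (s ⟶? a) ×-dec (a ⟶? b) ×-dec (b ⟶? t)

  path₄? : Dec Path₄
  path₄? = any? λ a → any? λ c → any? λ b → W? a ×-dec W? c ×-dec W? b ×-dec
           (s ⟶? a) ×-dec (a ⟶? c) ×-dec (c ⟶? b) ×-dec (b ⟶? t)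

  path₅? : Dec Path₅
  path₅? = any? λ a → any? λ c → any? λ e → any? λ b → W? a ×-dec W? c ×-dec W? e ×-dec W? b ×-dec
           ¬? (a ≟ b) ×-dec (s ⟶? a) ×-dec (a ⟶? c) ×-dec (c ⟶? e) ×-dec (e ⟶? b) ×-dec (b ⟶? t)

  connection : ∀ {d} →
    (∀ u → d ≤ # ((u ⟶?_) ∩? W?) + (⟦ u ⟶? s ⟧ + ⟦ u ⟶? t ⟧)) →
    (∀ u → d ≤ # ((_⟶? u) ∩? W?) + (⟦ t ⟶? u ⟧ + ⟦ s ⟶? u ⟧)) →
    2 * # W? + 7 ≤ 7 * d → 3 ≤ d → Path₃ ⊎ Path₄ ⊎ Path₅
  connection out-degree in-degree 2#W+7≤7d 3≤d with path₃? | path₄? | path₅?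
  ... | yes p | _     | _     = inj₁ p
  ... | no _  | yes p | _     = inj₂ (inj₁ p)
  ... | no _  | no _  | yes p = inj₂ (inj₂ p)
  ... | no ¬p₃ | no ¬p₄ | no ¬p₅ = contradiction (record
    { out-degree = out-degree
    ; in-degree  = in-degree
    ; no-path₃   = λ Wa Wb sa ab bt → ¬p₃ (_ , _ , Wa , Wb , sa , ab , bt)
    ; no-path₄   = λ Wa Wc Wb sa ac cb bt → ¬p₄ (_ , _ , _ , Wa , Wc , Wb , sa , ac , cb , bt)
    ; no-path₅   = λ Wa Wc We Wb a≢b sa ac ce eb bt →
        ¬p₅ (_ , _ , _ , _ , Wa , Wc , We , Wb , a≢b , sa , ac , ce , eb , bt)
    }) (¬Separated {G = G} 2#W+7≤7d 3≤d)

-- Equality would make 3 divide `n`; this is where the hypothesis on `n` modulo 3 enters.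
n<3⌈n/3⌉ : ∀ n → 3 ∤ n → n < ⌈ n / 3 ⌉ * 3
n<3⌈n/3⌉ n 3∤n = ≤∧≢⇒< (+-cancelʳ-≤ 2 n _ (begin
  n + 2                           ≡⟨ m≡m%n+[m/n]*n (n + 2) 3 ⟩
  (n + 2) % 3 + ⌈ n / 3 ⌉ * 3     ≤⟨ +-monoˡ-≤ _ (≤-pred (m%n<n (n + 2) 3)) ⟩
  2 + ⌈ n / 3 ⌉ * 3               ≡⟨ +-comm 2 _ ⟩
  ⌈ n / 3 ⌉ * 3 + 2               ∎)) λ eq → 3∤n (divides ⌈ n / 3 ⌉ eq)
  where open ≤-Reasoning

module _ {G : OrientedGraph n} {r : ℕ} where
  open OrientedGraph G
  open Degrees G

  module Closing (n<3δ : n < δ⁰ * 3) (n≥ : 15 * (5 + 3 * r) ≤ n)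
                 {v y b z a w : Fin n} {pre : List (Fin n)}
                 (yb : y ⟶ b) (yz : y ⟶ z) (bz : b ⟶ z) (za : z ⟶ a) (zv : z ⟶ v) (av : a ⟶ v)
                 (|pre|≡ : length (w ∷ pre) ≡ 2 + 3 * r) (w⋯y : Walk G w (w ∷ pre) y)
                 (unique : Unique (w ∷ pre ++ y ∷ b ∷ z ∷ a ∷ []))
                 (v∉ : v ∉ w ∷ pre ++ y ∷ b ∷ z ∷ a ∷ []) where
    open Bounds {n} {5 + 3 * r} {δ⁰} (s≤s z≤n) n≥ n<3δ

    core F : List (Fin n)
    core = y ∷ b ∷ z ∷ a ∷ []
    F = pre ++ core
    W? = ∁? (_∈? v ∷ w ∷ F)
    f = 5 + 3 * r
    d = δ⁰ ∸ f

    |F| : length F ≡ f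
    |F| = trans (length-++ pre) (trans (cong (_+ 4) (cong (_∸ 1) |pre|≡)) (+-comm (suc (3 * r)) 4))

    #W+≤ : # W? + (7 + 3 * r) ≤ n
    #W+≤ = subst (λ l → # W? + (2 + l) ≤ n) |F| (#∉+length≤ (∉-∷ v∉ unique))

    -- The `f` vertices of `F` cost at most one neighbour each, while `v` and `w` keep their
    -- indicators.
    degree-outside : ∀ {P : Pred (Fin n) 0ℓ} (P? : Decidable P) →
                     δ⁰ ≤ # P? → d ≤ # (P? ∩? W?) + (⟦ P? v ⟧ + ⟦ P? w ⟧)
    degree-outside P? δ≤ = begin
      δ⁰ ∸ f                      ≤⟨ ∸-monoˡ-≤ f (≤-trans δ≤ (#-avoid P? (v ∷ w ∷ F))) ⟩
      m + (p + (q + ΣF)) ∸ f      ≡⟨ cong (λ z → m + z ∸ f) (sym (+-assoc p q ΣF)) ⟩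
      m + (p + q + ΣF) ∸ f        ≡⟨ cong (_∸ f) (sym (+-assoc m (p + q) ΣF)) ⟩
      m + (p + q) + ΣF ∸ f        ≤⟨ ∸-monoˡ-≤ f (+-monoʳ-≤ (m + (p + q)) ΣF≤f) ⟩
      m + (p + q) + f ∸ f         ≡⟨ m+n∸n≡m (m + (p + q)) f ⟩
      m + (p + q)                 ∎
      where
      open ≤-Reasoning
      m = # (P? ∩? W?)
      p = ⟦ P? v ⟧
      q = ⟦ P? w ⟧
      ΣF = sum (map (λ x → ⟦ P? x ⟧) F)
      ΣF≤f : ΣF ≤ f
      ΣF≤f = ≤-trans (sum-⟦⟧≤length P? F) (≤-reflexive |F|)

    out-deg : ∀ u → d ≤ # ((u ⟶?_) ∩? W?) + (⟦ u ⟶? v ⟧ + ⟦ u ⟶? w ⟧)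
    out-deg u = degree-outside (u ⟶?_) (δ⁰≤#out u)

    in-deg : ∀ u → d ≤ # ((_⟶? u) ∩? W?) + (⟦ w ⟶? u ⟧ + ⟦ v ⟶? u ⟧)
    in-deg u = subst (λ x → d ≤ # ((_⟶? u) ∩? W?) + x)
      (+-comm ⟦ v ⟶? u ⟧ ⟦ w ⟶? u ⟧) (degree-outside (_⟶? u) (δ⁰≤#in u))

    -- A return path of length 3, 4 or 5 has 2, 3 or 4 interior vertices and is completed by 4, 3 or
    -- 2 vertices of `core`. Since `core′` is a sublist, distinctness and the avoidance of `v` are
    -- inherited.
    finish : ∀ {int core′} → Walk G v (v ∷ int) w → Unique int → All (_∉ v ∷ w ∷ F) int →
             Walk G y core′ v → core′ ⊑ core → length int + length core′ ≡ 6 →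
             Σ[ C ∈ DirectedCycle G (3 * (3 + r)) ] LiesOn v C
    finish {int} {core′} v⋯w u int∉ y⋯v core′⊑ |int|+|core′| =
      closed-walk⇒cycle (v⋯w ⧺ w⋯y ⧺ y⋯v)
        (∉-∷ v∉rest (Unique.++⁺ u (Unique-resp-⊑ rest⊑ unique) λ (x∈int , x∈rest) →
          All.lookup int∉ x∈int (there (⊑-lookup rest⊑ x∈rest))))
        len
      where
      rest⊑ : (w ∷ pre ++ core′) ⊑ (w ∷ F)
      rest⊑ = refl ∷ ++⁺ (⊆-refl {x = pre}) core′⊑
      v∉rest : v ∉ int ++ w ∷ pre ++ core′
      v∉rest v∈ = [ (λ v∈int → All.lookup int∉ v∈int (here refl))
                  , v∉ ∘ ⊑-lookup rest⊑ ]′ (∈-++⁻ int v∈)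
      len : suc (length (int ++ w ∷ pre ++ core′)) ≡ 3 * (3 + r)
      len = begin
        suc (length (int ++ w ∷ pre ++ core′))
          ≡⟨ cong suc (length-++ int) ⟩
        suc (length int + length (w ∷ pre ++ core′))
          ≡⟨ cong (λ l → suc (length int + l)) (length-++ (w ∷ pre)) ⟩
        suc (length int + (length (w ∷ pre) + length core′))
          ≡⟨ cong (λ l → suc (length int + (l + length core′))) |pre|≡ ⟩
        suc (length int + (2 + 3 * r + length core′))
          ≡⟨ cycle-length r |int|+|core′| ⟩
        3 * (3 + r)  ∎
        where open ≡-Reasoning

    cycle : Σ[ C ∈ DirectedCycle G (3 * (3 + r)) ] LiesOn v C
    cycle = close (connection G W? v w out-deg in-deg (tight #W+≤) 3≤δ∸f)
      where
      close : Path₃ G W? v w ⊎ Path₄ G W? v w ⊎ Path₅ G W? v w →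
              Σ[ C ∈ DirectedCycle G (3 * (3 + r)) ] LiesOn v C
      close (inj₁ (_ , _ , Wa , Wb , va , ab , bw)) =
        finish (va ∷ ab ∷ bw ∷ [])
          ((arc⇒≢ ab ∷ []) ∷ [] ∷ []) (Wa ∷ Wb ∷ [])
          (yb ∷ bz ∷ za ∷ av ∷ []) (refl ∷ refl ∷ refl ∷ refl ∷ []) refl
      close (inj₂ (inj₁ (_ , _ , _ , Wa , Wc , Wb , va , ac , cb , bw))) =
        finish (va ∷ ac ∷ cb ∷ bw ∷ [])
          ((arc⇒≢ ac ∷ path₂⇒≢ ac cb ∷ []) ∷ (arc⇒≢ cb ∷ []) ∷ [] ∷ [])
          (Wa ∷ Wc ∷ Wb ∷ [])
          (yb ∷ bz ∷ zv ∷ []) (refl ∷ refl ∷ refl ∷ a ∷ʳ []) refl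
      close (inj₂ (inj₂ (_ , _ , _ , _ , Wa , Wc , We , Wb , a≢b , va , ac , ce , eb , bw))) =
        finish (va ∷ ac ∷ ce ∷ eb ∷ bw ∷ [])
          ((arc⇒≢ ac ∷ path₂⇒≢ ac ce ∷ a≢b ∷ []) ∷
           (arc⇒≢ ce ∷ path₂⇒≢ ce eb ∷ []) ∷ (arc⇒≢ eb ∷ []) ∷ [] ∷ [])
          (Wa ∷ Wc ∷ We ∷ Wb ∷ [])
          (yz ∷ zv ∷ []) (refl ∷ b ∷ʳ refl ∷ a ∷ʳ []) refl

  vertex-on-cycle : n < δ⁰ * 3 → 15 * (5 + 3 * r) ≤ n →
                    ∀ v → Σ[ C ∈ DirectedCycle G (3 * (3 + r)) ] LiesOn v C
  vertex-on-cycle n<3δ n≥ v = through-triangle (transitive-triangle n<3δ v)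
    where
    module _ {y b z a} (yb : y ⟶ b) (yz : y ⟶ z) (bz : b ⟶ z)
             (za : z ⟶ a) (zv : z ⟶ v) (av : a ⟶ v) where

      unique : Unique (y ∷ b ∷ z ∷ a ∷ [])
      unique = (arc⇒≢ yb ∷ arc⇒≢ yz ∷ path₂⇒≢ yz za ∷ []) ∷
               (arc⇒≢ bz ∷ path₂⇒≢ bz za ∷ []) ∷ (arc⇒≢ za ∷ []) ∷ [] ∷ []

      v∉ : v ∉ y ∷ b ∷ z ∷ a ∷ []
      v∉ (here refl)                         = asym yz zv
      v∉ (there (here refl))                 = asym bz zv
      v∉ (there (there (here refl)))         = asym zv zv
      v∉ (there (there (there (here refl)))) = asym av av

      through-extension : ∃[ w ] ∃[ pre ] length pre ≡ 2 + 3 * r × Walk G w pre y ×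
        Unique (pre ++ y ∷ b ∷ z ∷ a ∷ []) × v ∉ pre ++ y ∷ b ∷ z ∷ a ∷ [] →
        Σ[ C ∈ DirectedCycle G (3 * (3 + r)) ] LiesOn v C
      -- The extension is nonempty, so the walk starts with an arc and its list with `w`.
      through-extension (_ , _ ∷ _ , |pre|≡ , w⋯y@(_ ∷ _) , unique , v∉) =
        Closing.cycle n<3δ n≥ yb yz bz za zv av |pre|≡ w⋯y unique v∉

    through-triangle : ∃[ z ] ∃[ a ] z ⟶ a × z ⟶ v × a ⟶ v →
                       Σ[ C ∈ DirectedCycle G (3 * (3 + r)) ] LiesOn v C
    through-triangle (z , a , za , zv , av) with y , b , yb , yz , bz ← transitive-triangle n<3δ z =
      through-extension yb yz bz za zv av
        -- These are 3q - 7 steps. Their vertices, the four of the core and `v` make 7 + 3r = f + 2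
        -- in all, which is within the semidegree.
        (extend-backwards (2 + 3 * r) (unique yb yz bz za zv av) (v∉ yb yz bz za zv av)
          (Bounds.2+f≤δ {n} (s≤s z≤n) n≥ n<3δ))

corollary2p8 : (q n : ℕ) → q ≥ 3 → 3 ∤ n → n ≥ 45 * q ∸ 60 →
    (G : OrientedGraph n) → OrientedGraph.δ⁰ G ≥ ⌈ n / 3 ⌉ →
    (v : Fin n) → Σ[ C ∈ DirectedCycle G (3 * q) ] LiesOn v C
corollary2p8 q n q≥3 3∤n n≥ G δ≥ v with r , refl ← ≤⇒∃+ q≥3 =
  vertex-on-cycle {r = r} (≤-trans (n<3⌈n/3⌉ n 3∤n) (*-monoˡ-≤ 3 δ≥)) (15f≤n r n≥) v
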